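{- Let $n = \sum_{i=1}^{k} n_i h_i$ and suppose a holey self-orthogonal latin square HSOLS$(h_1^{n_1}\cdots h_k^{n_k})$ of order $n$ exists. Suppose moreover that for each $i \in \{1,\dots,k\}$ there exist complete mixed doubles round robin tournaments CMDRR$(h_i, m_{i1}), \dots,$ CMDRR$(h_i, m_{i n_i})$. Then there exists a CMDRR$(n, s)$, where $s = \sum_{1 \le i \le k}\sum_{1 \le j \le n_i} m_{ij}$.
   Context: A mixed doubles game is a match between two teams, each team consisting of one man and one woman; in a game $M_a F_b$ v $M_c F_d$, $M_a$ and $F_b$ are partners, $M_c$ and $F_d$ are partners, and each player of one team opposes each player of the other team. A complete mixed doubles round robin tournament CMDRR$(n,k)$ is a schedule (set) of mixed doubles games for $n$ men and $n$ women, of which $k$ men and $k$ women are paired into $k$ spouse pairs (a spouse pair is one man and one woman), such that: spouses never play in a game together as partners or opponents; every man and woman who are not spouses are partners exactly once and opponents exactly once; each player who has a spouse opposes every other player of the same sex exactly once; each player who does not have a spouse opposes some other same-sex player who does not have a spouse exactly twice and opposes all other same-sex players exactly once. By convention a CMDRR$(1,1)$ exists (one spouse pair and no games). A self-orthogonal latin square (SOLS) is a latin square orthogonal to its transpose. A holey SOLS HSOLS$(h_1^{n_1}\cdots h_k^{n_k})$ is a self-orthogonal latin square of order $n=\sum n_i h_i$ with, for each $i$, $n_i$ missing sub-SOLS (holes) of order $h_i$, the holes being disjoint and spanning (i.e. the symbol set is partitioned into the holes, and the cells indexed by pairs of rows/columns from the same hole are empty and the symbols of a hole do not occur in that hole's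 rows or columns). -}

module Defs where

open import Data.Fin.Base using (Fin)
open import Data.Fin.Properties using (_≟_)
open import Data.Fin.Subset using (Subset; _∈_; ∣_∣)
open import Data.List.Base using (List; length; filter)
open import Data.Maybe.Base using (Maybe; just; nothing)
open import Data.Nat.Base using (ℕ; _*_)
open import Data.Nat.Properties using (+-0-commutativeMonoid)
open import Data.Product using (Σ-syntax; ∃; ∃!; _×_; proj₁; uncurry)
open import Data.Sum.Base using (_⊎_)
open import Function.Base using (flip)
open import Function.Bundles using (_⇔_)
open import Function.Definitions using (Injective)
open import Relation.Binary.PropositionalEquality using (_≡_; _≢_)
open import Relation.Nullary using (¬_)
open import Relation.Nullary.Decidable using (_×-dec_; _⊎-dec_)
open import Level using (0ℓ)
open import Relation.Unary using (Pred; Decidable)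

open import Algebra.Properties.CommutativeMonoid.Sum +-0-commutativeMonoid public
  using (sum)

-- The players are n men and n women, each set indexed by Fin n. The game
-- "man₁ woman₁ v man₂ woman₂" involves four different people. The same game
-- can be written with its two teams in either order; the relations below do
-- not depend on that order.
record Game (n : ℕ) : Set where
  field
    man₁ woman₁ man₂ woman₂ : Fin n
    man₁≢man₂     : man₁ ≢ man₂
    woman₁≢woman₂ : woman₁ ≢ woman₂

module _ {n : ℕ} where
  open Game

  Partners : (m w : Fin n) → Game n → Set
  Partners m w g = (man₁ g ≡ m × woman₁ g ≡ w) ⊎ (man₂ g ≡ m × woman₂ g ≡ w)

  Opponents : (m w : Fin n) → Game n → Set
  Opponents m w g = (man₁ g ≡ m × woman₂ g ≡ w) ⊎ (man₂ g ≡ m × woman₁ g ≡ w)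

  MenOppose : (m m′ : Fin n) → Game n → Set
  MenOppose m m′ g = (man₁ g ≡ m × man₂ g ≡ m′) ⊎ (man₂ g ≡ m × man₁ g ≡ m′)

  WomenOppose : (w w′ : Fin n) → Game n → Set
  WomenOppose w w′ g =
    (woman₁ g ≡ w × woman₂ g ≡ w′) ⊎ (woman₂ g ≡ w × woman₁ g ≡ w′)

  partners? : ∀ m w → Decidable (Partners m w)
  partners? m w g =
    (man₁ g ≟ m ×-dec woman₁ g ≟ w) ⊎-dec (man₂ g ≟ m ×-dec woman₂ g ≟ w)

  opponents? : ∀ m w → Decidable (Opponents m w)
  opponents? m w g =
    (man₁ g ≟ m ×-dec woman₂ g ≟ w) ⊎-dec (man₂ g ≟ m ×-dec woman₁ g ≟ w)

  menOppose? : ∀ m m′ → Decidable (MenOppose m m′)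
  menOppose? m m′ g =
    (man₁ g ≟ m ×-dec man₂ g ≟ m′) ⊎-dec (man₂ g ≟ m ×-dec man₁ g ≟ m′)

  womenOppose? : ∀ w w′ → Decidable (WomenOppose w w′)
  womenOppose? w w′ g =
    (woman₁ g ≟ w ×-dec woman₂ g ≟ w′) ⊎-dec (woman₂ g ≟ w ×-dec woman₁ g ≟ w′)

count : {A : Set} {P : Pred A 0ℓ} → Decidable P → List A → ℕ
count P? xs = length (filter P? xs)

-- The requirement on opponents of the same sex, stated once for both sexes:
-- `meetings x y` is the number of games in which x opposes y.
record SameSexOpposition {n : ℕ} (HasSpouse : Fin n → Set)
                         (meetings : Fin n → Fin n → ℕ) : Set where
  field
    spoused   : ∀ x → HasSpouse x → ∀ y → y ≢ x → meetings x y ≡ 1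
    unspoused : ∀ x → ¬ HasSpouse x →
                ∃ λ y → y ≢ x × ¬ HasSpouse y × meetings x y ≡ 2 ×
                        (∀ z → z ≢ x → z ≢ y → meetings x z ≡ 1)

-- The schedule is a list, but it cannot repeat a game: the fields spouses-apart
-- and partners-once let no man and woman be partners in more than one game.
record CMDRR (n k : ℕ) : Set where
  field
    husband wife      : Fin k → Fin n
    husband-injective : Injective _≡_ _≡_ husband
    wife-injective    : Injective _≡_ _≡_ wife
    games             : List (Game n)

  Spouses : Fin n → Fin n → Set
  Spouses m w = ∃ λ p → husband p ≡ m × wife p ≡ w

  field
    spouses-apart  : ∀ m w → Spouses m w →
                     count (partners? m w) games ≡ 0 ×
                     count (opponents? m w) games ≡ 0
    partners-once  : ∀ m w → ¬ Spouses m w → count (partners? m w) games ≡ 1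
    opponents-once : ∀ m w → ¬ Spouses m w → count (opponents? m w) games ≡ 1
    men   : SameSexOpposition (λ m → ∃ λ w → Spouses m w)
                              (λ m m′ → count (menOppose? m m′) games)
    women : SameSexOpposition (λ w → ∃ λ m → Spouses m w)
                              (λ w w′ → count (womenOppose? w w′) games)

-- Rows, columns and symbols are all indexed by Fin n; `nothing` is an empty
-- cell.
Square : ℕ → Set
Square n = Fin n → Fin n → Maybe (Fin n)

transpose : ∀ {n} → Square n → Square n
transpose = flip

-- In the next two definitions `_~_` is the relation "lie in a common hole".
record IsHoleyLatin {n : ℕ} (_~_ : Fin n → Fin n → Set) (L : Square n) : Set where
  field
    empty       : ∀ x y → L x y ≡ nothing ⇔ x ~ y
    row         : ∀ x a → ¬ x ~ a → ∃! _≡_ λ y → L x y ≡ just a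
    row-hole    : ∀ x a → x ~ a → ∀ y → L x y ≢ just a
    column      : ∀ y a → ¬ y ~ a → ∃! _≡_ λ x → L x y ≡ just a
    column-hole : ∀ y a → y ~ a → ∀ x → L x y ≢ just a

-- Superposing L and M gives each ordered pair of symbols not lying in a common
-- hole exactly once. For holey latin L and M those pairs are as many as the
-- filled cells, so no other pair arises.
Orthogonal : ∀ {n} → (Fin n → Fin n → Set) → Square n → Square n → Set
Orthogonal _~_ L M = ∀ a b → ¬ a ~ b →
  ∃! _≡_ (uncurry λ x y → L x y ≡ just a × M x y ≡ just b)

order : ∀ {k} → (h n : Fin k → ℕ) → ℕ
order h n = sum λ i → n i * h i

-- HSOLS h n has type h₁^n₁ ⋯ h_k^n_k: the holes are indexed by pairs (i , j)
-- with j : Fin (n i), and hole (i , j) has h i elements.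
record HSOLS {k : ℕ} (h n : Fin k → ℕ) : Set where
  field
    hole           : Σ[ i ∈ Fin k ] Fin (n i) → Subset (order h n)
    hole-size      : ∀ p → ∣ hole p ∣ ≡ h (proj₁ p)
    hole-partition : ∀ x → ∃! _≡_ λ p → x ∈ hole p

  SameHole : Fin (order h n) → Fin (order h n) → Set
  SameHole x y = ∃ λ p → x ∈ hole p × y ∈ hole p

  field
    square          : Square (order h n)
    latin           : IsHoleyLatin SameHole square
    self-orthogonal : Orthogonal SameHole square (transpose square)

{-# OPTIONS --safe #-}
module Submission where

-- For each two players x < y from different holes schedule the game
-- M_x F_{L(x,y)} v M_y F_{L(y,x)}, where L is the holey SOLS, and schedule the
-- given tournaments inside the holes. Two people from one hole meet only in the
-- tournament of that hole. Two people from different holes meet only in games of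
-- the first kind, exactly once: for partners this is the row property of L, for
-- a man and a woman as opponents it is the column property, and for two women it
-- is self-orthogonality.

open import Data.Nat.Base using (ℕ; zero; suc; _+_; _*_)
open import Data.Nat.Properties using (+-identityʳ; 1+n≰n)
open import Data.Fin.Base
  using (Fin; zero; suc; _<_; splitAt; join; punchOut; combine; remQuot)
open import Data.Fin.Properties
  using (_≟_; _<?_; <-cmp; <-asym; any?; splitAt-join; join-splitAt; punchInᵢ≢i;
         punchOut-injective; injective⇒≤; combine-injective; combine-remQuot;
         suc-injective)
open import Data.Fin.Subset using (Subset; _∈_; ∣_∣; inside; outside)
open import Data.List.Base using (List; []; _∷_; _++_; [_]; map; concat; tabulate; length; filter)
open import Data.List.Properties using (filter-++; filter-none; filter-accept; length-++)
import Data.List.Relation.Unary.All as All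
import Data.List.Relation.Unary.All.Properties as All
open import Data.Maybe.Base using (just; nothing; fromMaybe)
open import Data.Maybe.Properties using (just-injective)
open import Data.Product.Base using (Σ; ∃; ∃₂; _×_; _,_; proj₁; proj₂; uncurry)
open import Data.Product.Properties using (≡-dec)
open import Data.Sum.Base using (_⊎_; inj₁; inj₂)
import Data.Sum.Base as Sum
open import Data.Vec.Base using ([]; _∷_; here; there)
open import Data.Vec.Functional using (removeAt)
open import Function.Base using (_∘_; const)
open import Function.Bundles using (_⇔_; mk⇔; _↔_; mk↔ₛ′; Equivalence; Inverse)
open import Function.Definitions using (Injective)
open import Level using (0ℓ)
open import Relation.Binary.Definitions using (DecidableEquality; tri<; tri≈; tri>)
open import Relation.Binary.PropositionalEquality
  using (_≡_; _≢_; refl; sym; trans; cong; cong₂; subst; subst₂; module ≡-Reasoning)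
open import Relation.Nullary using (¬_; yes; no; contradiction)
open import Relation.Nullary.Decidable using (_×-dec_; _⊎-dec_)
open import Relation.Unary using (Pred; Decidable)
open import Algebra.Properties.CommutativeMonoid.Sum
  Data.Nat.Properties.+-0-commutativeMonoid
  using (sum-remove; sum-cong-≗; sum-replicate-zero)
open import Defs

-- Finite sums and finite sets

sum-zero : ∀ {k} (f : Fin k → ℕ) → (∀ i → f i ≡ 0) → sum f ≡ 0
sum-zero {k} f f≡0 = trans (sum-cong-≗ f≡0) (sum-replicate-zero k)

sum-single : ∀ {k} (f : Fin k → ℕ) i → (∀ j → j ≢ i → f j ≡ 0) → sum f ≡ f i
sum-single {suc k} f i f≡0 = begin
  sum f                       ≡⟨ sum-remove {i = i} f ⟩
  f i + sum (removeAt f i)    ≡⟨ cong (f i +_) (sum-zero (removeAt f i) λ j → f≡0 _ (punchInᵢ≢i i j)) ⟩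
  f i + 0                     ≡⟨ +-identityʳ (f i) ⟩
  f i                         ∎
  where open ≡-Reasoning

sum↔Σ : ∀ {k} (f : Fin k → ℕ) → Fin (sum f) ↔ Σ (Fin k) (Fin ∘ f)
sum↔Σ {zero}  f = mk↔ₛ′ (λ ()) (λ ()) (λ ()) (λ ())
sum↔Σ {suc k} f = mk↔ₛ′ to from to-from from-to
  where
  module R = Inverse (sum↔Σ (f ∘ suc))

  shift : Fin (f zero) ⊎ Fin (sum (f ∘ suc)) → Σ (Fin (suc k)) (Fin ∘ f)
  shift (inj₁ r) = zero , r
  shift (inj₂ r) = suc (proj₁ (R.to r)) , proj₂ (R.to r)

  unshift : Σ (Fin (suc k)) (Fin ∘ f) → Fin (f zero) ⊎ Fin (sum (f ∘ suc))
  unshift (zero  , r) = inj₁ r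
  unshift (suc i , r) = inj₂ (R.from (i , r))

  shift-unshift : ∀ p → shift (unshift p) ≡ p
  shift-unshift (zero  , r) = refl
  shift-unshift (suc i , r) =
    cong (λ q → suc (proj₁ q) , proj₂ q) (R.strictlyInverseˡ (i , r))

  unshift-shift : ∀ s → unshift (shift s) ≡ s
  unshift-shift (inj₁ r) = refl
  unshift-shift (inj₂ r) = cong inj₂ (R.strictlyInverseʳ r)

  to : Fin (sum f) → Σ (Fin (suc k)) (Fin ∘ f)
  to = shift ∘ splitAt (f zero)

  from : Σ (Fin (suc k)) (Fin ∘ f) → Fin (sum f)
  from = join (f zero) _ ∘ unshift

  to-from : ∀ p → to (from p) ≡ p
  to-from p = trans (cong shift (splitAt-join (f zero) _ (unshift p))) (shift-unshift p)

  from-to : ∀ q → from (to q) ≡ q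
  from-to q = trans (cong (join (f zero) _) (unshift-shift (splitAt (f zero) q)))
                    (join-splitAt (f zero) _ q)

-- This will index the spouse pairs: a number below the double sum becomes a hole together with a
-- spouse pair of that hole's tournament.
sum-sum↔Σ : ∀ {k} (n : Fin k → ℕ) (m : ∀ i → Fin (n i) → ℕ) →
            Fin (sum λ i → sum λ j → m i j) ↔ Σ (Σ (Fin k) (Fin ∘ n)) (Fin ∘ uncurry m)
sum-sum↔Σ {k} n m = mk↔ₛ′ to from to-from from-to
  where
  module O = Inverse (sum↔Σ λ i → sum (m i))
  module I i = Inverse (sum↔Σ (m i))

  regroup : Σ (Fin k) (λ i → Fin (sum (m i))) → Σ (Σ (Fin k) (Fin ∘ n)) (Fin ∘ uncurry m)
  regroup (i , r) = (i , proj₁ (I.to i r)) , proj₂ (I.to i r)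

  to : _ → Σ (Σ (Fin k) (Fin ∘ n)) (Fin ∘ uncurry m)
  to = regroup ∘ O.to

  from : Σ (Σ (Fin k) (Fin ∘ n)) (Fin ∘ uncurry m) → _
  from ((i , j) , r) = O.from (i , I.from i (j , r))

  to-from : ∀ p → to (from p) ≡ p
  to-from ((i , j) , r) =
    trans (cong regroup (O.strictlyInverseˡ _))
          (cong (λ q → (i , proj₁ q) , proj₂ q) (I.strictlyInverseˡ i (j , r)))

  from-to : ∀ q → from (to q) ≡ q
  from-to q = trans (cong (λ r → O.from (proj₁ (O.to q) , r)) (I.strictlyInverseʳ _ _))
                    (O.strictlyInverseʳ q)

-- If some `y` were missed, punching it out of the codomain would leave an injection from
-- `Fin (suc n)` into `Fin n`.
injective⇒surjective : ∀ {n} {f : Fin n → Fin n} → Injective _≡_ _≡_ f →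
                       ∀ y → ∃ λ x → f x ≡ y
injective⇒surjective {suc n} {f} f-injective y with any? (λ x → f x ≟ y)
... | yes hit  = hit
... | no  miss = contradiction
  (injective⇒≤ {f = λ x → punchOut (y≢ x)} λ eq → f-injective (punchOut-injective (y≢ _) (y≢ _) eq))
  1+n≰n
  where
  y≢ : ∀ x → y ≢ f x
  y≢ x y≡fx = miss (x , sym y≡fx)

injective⇒surjective-× : ∀ {m n} {f : Fin m × Fin n → Fin m × Fin n} → Injective _≡_ _≡_ f →
                         ∀ y → ∃ λ x → f x ≡ y
injective⇒surjective-× {m} {n} {f} f-injective y =
  let x , eq = injective⇒surjective {f = uncurry combine ∘ f ∘ remQuot {m} n} inj (uncurry combine y)
  in  remQuot {m} n x , combine-inj eq
  where
  combine-inj : ∀ {p q : Fin m × Fin n} → uncurry combine p ≡ uncurry combine q → p ≡ q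
  combine-inj eq = let l , r = combine-injective _ _ _ _ eq in cong₂ _,_ l r

  inj : Injective _≡_ _≡_ (uncurry combine ∘ f ∘ remQuot {m} n)
  inj {i} {j} eq = begin
    i                              ≡⟨ combine-remQuot {m} n i ⟨
    uncurry combine (remQuot {m} n i)  ≡⟨ cong (uncurry combine) (f-injective (combine-inj eq)) ⟩
    uncurry combine (remQuot {m} n j)  ≡⟨ combine-remQuot {m} n j ⟩
    j                              ∎
    where open ≡-Reasoning

-- The size is a parameter separate from `∣ s ∣`, so that an enumeration can be transported along
-- `hole-size` to `Fin (h i)`, the index type of the given tournaments.
record Enumeration {n : ℕ} (s : Subset n) (size : ℕ) : Set where
  field
    element    : Fin size → Fin n
    injective  : Injective _≡_ _≡_ element
    sound      : ∀ u → element u ∈ s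
    complete   : ∀ {x} → x ∈ s → ∃ λ u → element u ≡ x

enumerate : ∀ {n} (s : Subset n) → Enumeration s ∣ s ∣
enumerate []            = record
  { element = λ () ; injective = λ {} ; sound = λ () ; complete = λ () }
enumerate (outside ∷ s) = record
  { element   = suc ∘ element
  ; injective = injective ∘ suc-injective
  ; sound     = there ∘ sound
  ; complete  = λ { (there x∈s) → let u , eq = complete x∈s in u , cong suc eq }
  }
  where open Enumeration (enumerate s)
enumerate (inside ∷ s)  = record
  { element   = elt
  ; injective = λ {u} {v} → inj u v
  ; sound     = λ { zero → here ; (suc u) → there (sound u) }
  ; complete  = λ { here        → zero , refl
                  ; (there x∈s) → let u , eq = complete x∈s in suc u , cong suc eq }
  }
  where
  open Enumeration (enumerate s)

  elt : Fin (suc ∣ s ∣) → Fin _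
  elt zero    = zero
  elt (suc u) = suc (element u)

  inj : ∀ u v → elt u ≡ elt v → u ≡ v
  inj zero    zero    _  = refl
  inj (suc u) (suc v) eq = cong suc (injective (suc-injective eq))

-- Counting in lists

module _ {A : Set} {P : Pred A 0ℓ} (P? : Decidable P) where

  count-++ : ∀ xs ys → count P? (xs ++ ys) ≡ count P? xs + count P? ys
  count-++ xs ys = trans (cong length (filter-++ P? xs ys)) (length-++ (filter P? xs))

  count-map : ∀ {B : Set} {Q : Pred B 0ℓ} (Q? : Decidable Q) {f : B → A} →
              (∀ x → P (f x) ⇔ Q x) → ∀ xs → count P? (map f xs) ≡ count Q? xs
  count-map Q? P⇔Q []       = refl
  count-map Q? {f} P⇔Q (x ∷ xs) with P? (f x) | Q? x
  ... | yes _ | yes _ = cong suc (count-map Q? P⇔Q xs)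
  ... | no  _ | no  _ = count-map Q? P⇔Q xs
  ... | yes p | no ¬q = contradiction (Equivalence.to (P⇔Q x) p) ¬q
  ... | no ¬p | yes q = contradiction (Equivalence.from (P⇔Q x) q) ¬p

  count-map-none : ∀ {B : Set} {f : B → A} → (∀ x → ¬ P (f x)) →
                   ∀ xs → count P? (map f xs) ≡ 0
  count-map-none ¬P xs = cong length (filter-none P? (All.map⁺ (All.universal ¬P xs)))

  count-[-] : ∀ {x} → P x → count P? [ x ] ≡ 1
  count-[-] = cong length ∘ filter-accept P?

-- Serves two index sets: the holes, and, with `n` constant, the ordered pairs of players.
⋃ : ∀ {A : Set} {k} {n : Fin k → ℕ} → (Σ (Fin k) (Fin ∘ n) → List A) → List A
⋃ f = concat (tabulate λ i → concat (tabulate λ j → f (i , j)))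

module _ {A : Set} {P : Pred A 0ℓ} (P? : Decidable P) where

  count-concat : ∀ {k} (f : Fin k → List A) →
                 count P? (concat (tabulate f)) ≡ sum (count P? ∘ f)
  count-concat {zero}  f = refl
  count-concat {suc k} f =
    trans (count-++ P? (f zero) _) (cong (count P? (f zero) +_) (count-concat (f ∘ suc)))

  module _ {k} {n : Fin k → ℕ} (f : Σ (Fin k) (Fin ∘ n) → List A) where

    count-⋃ : count P? (⋃ f) ≡ sum λ i → sum λ j → count P? (f (i , j))
    count-⋃ = trans (count-concat λ i → concat (tabulate λ j → f (i , j)))
                    (sum-cong-≗ λ i → count-concat λ j → f (i , j))

    count-⋃-zero : (∀ p → count P? (f p) ≡ 0) → count P? (⋃ f) ≡ 0
    count-⋃-zero f≡0 = trans count-⋃ (sum-zero _ λ i → sum-zero _ λ j → f≡0 (i , j))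

    count-⋃-single : ∀ p → (∀ q → q ≢ p → count P? (f q) ≡ 0) →
                     count P? (⋃ f) ≡ count P? (f p)
    count-⋃-single (i , j) f≡0 = trans count-⋃ (trans
      (sum-single _ i λ i′ i′≢i → sum-zero _ λ j′ → f≡0 (i′ , j′) (i′≢i ∘ cong proj₁))
      (sum-single _ j λ j′ j′≢j → f≡0 (i , j′) λ { refl → j′≢j refl }))

-- Seats of a game

-- With seats as data, one counting argument covers partners, mixed opponents, men and women.
data Seat : Set where
  man₁ woman₁ man₂ woman₂ : Seat

at : ∀ {n} → Seat → Game n → Fin n
at man₁   = Game.man₁
at woman₁ = Game.woman₁
at man₂   = Game.man₂
at woman₂ = Game.woman₂

opposite : Seat → Seat
opposite man₁   = man₂
opposite woman₁ = woman₂
opposite man₂   = man₁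
opposite woman₂ = woman₁

-- Partners, Opponents, MenOppose and WomenOppose are the instances with
-- (s , t) = (man₁ , woman₁), (man₁ , woman₂), (man₁ , man₂), (woman₁ , woman₂).
Meet : ∀ {n} → Seat → Seat → Fin n → Fin n → Game n → Set
Meet s t a b g = (at s g ≡ a × at t g ≡ b) ⊎ (at (opposite s) g ≡ a × at (opposite t) g ≡ b)

-- At the four instances this reduces to `partners?`, `opponents?`, `menOppose?` and `womenOppose?`,
-- so counts with `meet?` are already the counts that `CMDRR` asks for.
meet? : ∀ {n} s t (a b : Fin n) → Decidable (Meet s t a b)
meet? s t a b g =
  (at s g ≟ a ×-dec at t g ≟ b) ⊎-dec (at (opposite s) g ≟ a ×-dec at (opposite t) g ≟ b)

module _ {m n} (f : Fin m → Fin n) (f-injective : Injective _≡_ _≡_ f) where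

  mapGame : Game m → Game n
  mapGame g = record
    { man₁ = f (Game.man₁ g) ; woman₁ = f (Game.woman₁ g)
    ; man₂ = f (Game.man₂ g) ; woman₂ = f (Game.woman₂ g)
    ; man₁≢man₂     = Game.man₁≢man₂ g ∘ f-injective
    ; woman₁≢woman₂ = Game.woman₁≢woman₂ g ∘ f-injective
    }

  at-mapGame : ∀ s g → at s (mapGame g) ≡ f (at s g)
  at-mapGame man₁   g = refl
  at-mapGame woman₁ g = refl
  at-mapGame man₂   g = refl
  at-mapGame woman₂ g = refl

  Meet-mapGame : ∀ s t u v g → Meet s t (f u) (f v) (mapGame g) ⇔ Meet s t u v g
  Meet-mapGame s t u v g = mk⇔ (Sum.map (both⁻ s t) (both⁻ (opposite s) (opposite t)))
                               (Sum.map (both⁺ s t) (both⁺ (opposite s) (opposite t)))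
    where
    both⁻ : ∀ s t → at s (mapGame g) ≡ f u × at t (mapGame g) ≡ f v → at s g ≡ u × at t g ≡ v
    both⁻ s t (p , q) = f-injective (trans (sym (at-mapGame s g)) p)
                      , f-injective (trans (sym (at-mapGame t g)) q)

    both⁺ : ∀ s t → at s g ≡ u × at t g ≡ v → at s (mapGame g) ≡ f u × at t (mapGame g) ≡ f v
    both⁺ s t (p , q) = trans (at-mapGame s g) (cong f p) , trans (at-mapGame t g) (cong f q)

  Meet-mapGame⇒image : ∀ s t {a b} g → Meet s t a b (mapGame g) →
                       (∃ λ u → f u ≡ a) × (∃ λ v → f v ≡ b)
  Meet-mapGame⇒image s t g (inj₁ (p , q)) =
    (_ , trans (sym (at-mapGame s g)) p) , (_ , trans (sym (at-mapGame t g)) q)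
  Meet-mapGame⇒image s t g (inj₂ (p , q)) =
    (_ , trans (sym (at-mapGame (opposite s) g)) p) , (_ , trans (sym (at-mapGame (opposite t) g)) q)

-- Filling the holes

module Construction {k : ℕ} (h n : Fin k → ℕ) (m : (i : Fin k) → Fin (n i) → ℕ)
                    (S : HSOLS h n) (C : ∀ i j → CMDRR (h i) (m i j)) where
  open HSOLS S
  open IsHoleyLatin latin
  module C p = CMDRR (C (proj₁ p) (proj₂ p))

  N : ℕ
  N = order h n

  -- Holes and the players in them

  Hole : Set
  Hole = Σ (Fin k) (Fin ∘ n)

  _≟ʰ_ : DecidableEquality Hole
  _≟ʰ_ = ≡-dec _≟_ _≟_

  holeOf : Fin N → Hole
  holeOf x = proj₁ (hole-partition x)

  ∈-holeOf : ∀ x → x ∈ hole (holeOf x)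
  ∈-holeOf x = proj₁ (proj₂ (hole-partition x))

  holeOf-unique : ∀ {x p} → x ∈ hole p → holeOf x ≡ p
  holeOf-unique {x} = proj₂ (proj₂ (hole-partition x))

  _#_ : Fin N → Fin N → Set
  x # y = holeOf x ≢ holeOf y

  #⇒¬SameHole : ∀ {x y} → x # y → ¬ SameHole x y
  #⇒¬SameHole x#y (p , x∈p , y∈p) = x#y (trans (holeOf-unique x∈p) (sym (holeOf-unique y∈p)))

  ¬SameHole⇒# : ∀ {x y} → ¬ SameHole x y → x # y
  ¬SameHole⇒# {x} {y} x≁y eq =
    x≁y (holeOf x , ∈-holeOf x , subst (λ p → y ∈ hole p) (sym eq) (∈-holeOf y))

  enum : ∀ p → Enumeration (hole p) (h (proj₁ p))
  enum p = subst (Enumeration (hole p)) (hole-size p) (enumerate (hole p))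

  player : ∀ p → Fin (h (proj₁ p)) → Fin N
  player p = Enumeration.element (enum p)

  player-injective : ∀ p → Injective _≡_ _≡_ (player p)
  player-injective p = Enumeration.injective (enum p)

  holeOf-player : ∀ p u → holeOf (player p u) ≡ p
  holeOf-player p u = holeOf-unique (Enumeration.sound (enum p) u)

  -- Matching on `localise x` rewrites an arbitrary player as member `u` of a hole `p`. With
  -- `relative` for a second player, this gives the case distinction of all later verifications: one
  -- hole, or two.
  data Local : Fin N → Set where
    local : ∀ p u → Local (player p u)

  localise : ∀ x → Local x
  localise x with u , eq ← Enumeration.complete (enum (holeOf x)) (∈-holeOf x) =
    subst Local eq (local (holeOf x) u)

  relative : ∀ p u y → (∃ λ v → player p v ≡ y) ⊎ player p u # y
  relative p u y with localise y
  ... | local q v with p ≟ʰ q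
  ...   | yes refl = inj₁ (v , refl)
  ...   | no  p≢q  = inj₂ (subst₂ _≢_ (sym (holeOf-player p u)) (sym (holeOf-player q v)) p≢q)

  -- The default value x is attained only at empty cells.
  entry : Fin N → Fin N → Fin N
  entry x y = fromMaybe x (square x y)

  square≡entry : ∀ {x y} → x # y → square x y ≡ just (entry x y)
  square≡entry {x} {y} x#y with square x y in eq
  ... | just a  = refl
  ... | nothing = contradiction (Equivalence.to (empty x y) eq) (#⇒¬SameHole x#y)

  entry≡⇒square≡ : ∀ {x y a} → x # y → entry x y ≡ a → square x y ≡ just a
  entry≡⇒square≡ x#y eq = trans (square≡entry x#y) (cong just eq)

  square≡⇒entry≡ : ∀ {x y a} → square x y ≡ just a → entry x y ≡ a
  square≡⇒entry≡ {x} = cong (fromMaybe x)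

  square≡⇒# : ∀ {x y a} → square x y ≡ just a → x # y
  square≡⇒# {x} {y} eq = ¬SameHole⇒# λ x~y →
    contradiction (trans (sym eq) (Equivalence.from (empty x y) x~y)) λ ()

  -- Superposition of the square with its transpose

  superpose : ∀ {a b} → a # b → Fin N × Fin N
  superpose a#b = proj₁ (self-orthogonal _ _ (#⇒¬SameHole a#b))

  superpose-spec : ∀ {a b} (a#b : a # b) → let x , y = superpose a#b in
                   square x y ≡ just a × square y x ≡ just b
  superpose-spec a#b = proj₁ (proj₂ (self-orthogonal _ _ (#⇒¬SameHole a#b)))

  -- The map from pairs of symbols in different holes to the cell where they are
  -- superposed is injective; extended by the identity it permutes Fin N × Fin N,
  -- so it reaches every filled cell.
  cell : Fin N × Fin N → Fin N × Fin N
  cell (a , b) with holeOf a ≟ʰ holeOf b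
  ... | yes _   = a , b
  ... | no  a#b = superpose a#b

  cell-injective : Injective _≡_ _≡_ cell
  cell-injective {a , b} {c , d} eq with holeOf a ≟ʰ holeOf b | holeOf c ≟ʰ holeOf d
  ... | yes _   | yes _   = eq
  -- A cell returned by `superpose` is filled, so its row and column lie in different holes; a pair
  -- fixed by `cell` lies in one hole.
  ... | yes a~b | no c#d with refl ← eq =
    contradiction a~b (square≡⇒# (proj₁ (superpose-spec c#d)))
  ... | no a#b  | yes c~d with refl ← eq =
    contradiction c~d (square≡⇒# (proj₁ (superpose-spec a#b)))
  ... | no a#b  | no c#d =
    cong₂ _,_
      (just-injective (trans (sym (proj₁ ab))
        (trans (cong (λ p → square (proj₁ p) (proj₂ p)) eq) (proj₁ cd))))
      (just-injective (trans (sym (proj₂ ab))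
        (trans (cong (λ p → square (proj₂ p) (proj₁ p)) eq) (proj₂ cd))))
    where
    ab = superpose-spec a#b
    cd = superpose-spec c#d

  -- Self-orthogonality locates the pairs of symbols from different holes, but does not directly
  -- exclude other pairs from the filled cells; surjectivity of `cell` does. Hence the two women of
  -- a cross game are distinct, and women of one hole never oppose each other in such a game.
  entries-# : ∀ {x y} → x # y → entry x y # entry y x
  entries-# {x} {y} x#y
    with (a , b) , eq ← injective⇒surjective-× {f = cell} cell-injective (x , y)
    with holeOf a ≟ʰ holeOf b
  -- A preimage fixed by `cell` is `(x , y)` itself, contrary to `x # y`.
  ... | yes a~b with refl ← eq = contradiction a~b x#y
  ... | no a#b with superpose a#b | superpose-spec a#b
  ...   | _ | ab , ba with refl ← eq =
    subst₂ _#_ (sym (square≡⇒entry≡ ab)) (sym (square≡⇒entry≡ ba)) a#b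

  -- Games between different holes

  crossGame : ∀ x y → x # y → Game N
  crossGame x y x#y = record
    { man₁ = x ; woman₁ = entry x y ; man₂ = y ; woman₂ = entry y x
    ; man₁≢man₂     = x#y ∘ cong holeOf
    ; woman₁≢woman₂ = entries-# x#y ∘ cong holeOf
    }

  -- Depends on the cell alone and not on a proof of `x # y`, so that `x` and `y` can be exchanged
  -- freely; the exchange amounts to passing to opposite seats.
  occupant : Seat → Fin N → Fin N → Fin N
  occupant man₁   x y = x
  occupant woman₁ x y = entry x y
  occupant man₂   x y = y
  occupant woman₂ x y = entry y x

  at-crossGame : ∀ s {x y} (x#y : x # y) → at s (crossGame x y x#y) ≡ occupant s x y
  at-crossGame man₁   _ = refl
  at-crossGame woman₁ _ = refl
  at-crossGame man₂   _ = refl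
  at-crossGame woman₂ _ = refl

  occupant-opposite : ∀ s x y → occupant (opposite s) x y ≡ occupant s y x
  occupant-opposite man₁   x y = refl
  occupant-opposite woman₁ x y = refl
  occupant-opposite man₂   x y = refl
  occupant-opposite woman₂ x y = refl

  Occupy : Seat → Seat → (a b x y : Fin N) → Set
  Occupy s t a b x y = occupant s x y ≡ a × occupant t x y ≡ b

  Meet-crossGame : ∀ s t a b {x y} (x#y : x # y) →
    Meet s t a b (crossGame x y x#y) ⇔ (Occupy s t a b x y ⊎ Occupy s t a b y x)
  Meet-crossGame s t a b {x} {y} x#y
    rewrite at-crossGame s x#y | at-crossGame t x#y
          | at-crossGame (opposite s) x#y | at-crossGame (opposite t) x#y
          | occupant-opposite s x y | occupant-opposite t x y = mk⇔ (λ p → p) (λ p → p)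

  -- All that the counting needs from the square. Ordered pairs in both directions are considered,
  -- because the second team of the game at `(x , y)` sits as the first team would at `(y , x)`.
  record Transversal (s t : Seat) : Set where
    field
      occupants-# : ∀ {x y} → x # y → occupant s x y # occupant t x y
      meeting     : ∀ a b → a # b → ∃₂ λ x y → x # y × Occupy s t a b x y ×
                    (∀ {x′ y′} → x′ # y′ → Occupy s t a b x′ y′ → (x′ , y′) ≡ (x , y))

  partners-transversal : Transversal man₁ woman₁
  partners-transversal = record
    { occupants-# = λ {x} {y} x#y → ¬SameHole⇒# λ x~a → row-hole x _ x~a y (square≡entry x#y)
    ; meeting = λ a b a#b → let y , eq , unique = row a b (#⇒¬SameHole a#b) in
        a , y , square≡⇒# eq , (refl , square≡⇒entry≡ eq) ,
        λ { x#y (refl , eq′) → cong (a ,_) (sym (unique (entry≡⇒square≡ x#y eq′))) }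
    }

  -- `woman₂` at `(x , y)` is `entry y x`, so fixing the man `x` fixes a column; this is also why
  -- `x # y` gets reversed.
  opponents-transversal : Transversal man₁ woman₂
  opponents-transversal = record
    { occupants-# = λ {x} {y} x#y → ¬SameHole⇒# λ x~a →
        column-hole x _ x~a y (square≡entry (x#y ∘ sym))
    ; meeting = λ a b a#b → let y , eq , unique = column a b (#⇒¬SameHole a#b) in
        a , y , square≡⇒# eq ∘ sym , (refl , square≡⇒entry≡ eq) ,
        λ { x#y (refl , eq′) → cong (a ,_) (sym (unique (entry≡⇒square≡ (x#y ∘ sym) eq′))) }
    }

  men-transversal : Transversal man₁ man₂
  men-transversal = record
    { occupants-# = λ x#y → x#y
    ; meeting     = λ a b a#b → a , b , a#b , (refl , refl) , λ { _ (refl , refl) → refl }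
    }

  women-transversal : Transversal woman₁ woman₂
  women-transversal = record
    { occupants-# = entries-#
    ; meeting = λ a b a#b →
        let (x , y) , (eq₁ , eq₂) , unique = self-orthogonal a b (#⇒¬SameHole a#b) in
        x , y , square≡⇒# eq₁ , (square≡⇒entry≡ eq₁ , square≡⇒entry≡ eq₂) ,
        λ { x#y (eq₁′ , eq₂′) →
              sym (unique (entry≡⇒square≡ x#y eq₁′ , entry≡⇒square≡ (x#y ∘ sym) eq₂′)) }
    }

  -- The empty blocks allow indexing by all ordered pairs, while each unordered pair is scheduled
  -- only in its increasing order.
  crossBlock : Fin N × Fin N → List (Game N)
  crossBlock (x , y) with x <? y | holeOf x ≟ʰ holeOf y
  ... | yes _ | no x#y = [ crossGame x y x#y ]
  ... | yes _ | yes _  = []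
  ... | no _  | _      = []

  crossGames : List (Game N)
  crossGames = ⋃ {n = const N} crossBlock

  module _ (s t : Seat) (a b : Fin N) where

    Hit : Fin N × Fin N → Set
    Hit (x , y) = Occupy s t a b x y ⊎ Occupy s t a b y x

    count-crossBlock-zero : ∀ x y → (x < y → x # y → ¬ Hit (x , y)) →
                            count (meet? s t a b) (crossBlock (x , y)) ≡ 0
    count-crossBlock-zero x y ¬hit with x <? y | holeOf x ≟ʰ holeOf y
    ... | yes x<y | no x#y = cong length (filter-none (meet? s t a b)
      ((¬hit x<y x#y ∘ Equivalence.to (Meet-crossGame s t a b x#y)) All.∷ All.[]))
    ... | yes _   | yes _  = refl
    ... | no _    | _      = refl

    count-crossBlock-one : ∀ {x y} → x < y → x # y → Hit (x , y) →
                           count (meet? s t a b) (crossBlock (x , y)) ≡ 1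
    count-crossBlock-one {x} {y} x<y x#y hit with x <? y | holeOf x ≟ʰ holeOf y
    ... | yes _  | no x#y′ =
      count-[-] (meet? s t a b) (Equivalence.from (Meet-crossGame s t a b x#y′) hit)
    ... | yes _  | yes x~y = contradiction x~y x#y
    ... | no x≮y | _       = contradiction x<y x≮y

    count-crossGames-one : ∀ {x y} → x < y → x # y → Hit (x , y) →
      (∀ {x′ y′} → x′ < y′ → x′ # y′ → Hit (x′ , y′) → (x′ , y′) ≡ (x , y)) →
      count (meet? s t a b) crossGames ≡ 1
    count-crossGames-one {x} {y} x<y x#y hit unique = trans
      (count-⋃-single (meet? s t a b) crossBlock (x , y) λ { (x′ , y′) ≢xy →
        count-crossBlock-zero x′ y′ λ x′<y′ x′#y′ hit′ → ≢xy (unique x′<y′ x′#y′ hit′) })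
      (count-crossBlock-one x<y x#y hit)

  module _ {s t : Seat} (T : Transversal s t) {a b : Fin N} where
    open Transversal T

    count-crossGames-same : holeOf a ≡ holeOf b → count (meet? s t a b) crossGames ≡ 0
    count-crossGames-same a~b = count-⋃-zero (meet? s t a b) crossBlock λ { (x , y) →
      count-crossBlock-zero s t a b x y λ { _ x#y (inj₁ occ) → ¬occupy x#y occ
                                          ; _ x#y (inj₂ occ) → ¬occupy (x#y ∘ sym) occ } }
      where
      ¬occupy : ∀ {x y} → x # y → ¬ Occupy s t a b x y
      ¬occupy x#y (refl , refl) = occupants-# x#y a~b

    -- The transversal supplies one ordered pair `(x , y)` for `a` and `b`. If it is increasing, the
    -- scheduled game seats them at `s` and `t`; otherwise the game at `(y , x)` seats them at the
    -- opposite seats.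
    count-crossGames-# : a # b → count (meet? s t a b) crossGames ≡ 1
    count-crossGames-# a#b with meeting a b a#b
    ... | x , y , x#y , occ , unique with <-cmp x y
    ...   | tri< x<y _ _ = count-crossGames-one s t a b x<y x#y (inj₁ occ) only
      where
      only : ∀ {x′ y′} → x′ < y′ → x′ # y′ → Hit s t a b (x′ , y′) → (x′ , y′) ≡ (x , y)
      only _     x′#y′ (inj₁ occ′) = unique x′#y′ occ′
      -- A hit at the opposite seats would have to come from the same cell reversed, which is
      -- decreasing and therefore not scheduled.
      only x′<y′ x′#y′ (inj₂ occ′) with refl ← unique (x′#y′ ∘ sym) occ′ =
        contradiction x′<y′ (<-asym x<y)
    ...   | tri≈ _ refl _ = contradiction refl x#y
    ...   | tri> _ _ y<x = count-crossGames-one s t a b y<x (x#y ∘ sym) (inj₂ occ) only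
      where
      only : ∀ {x′ y′} → x′ < y′ → x′ # y′ → Hit s t a b (x′ , y′) → (x′ , y′) ≡ (y , x)
      only x′<y′ x′#y′ (inj₁ occ′) with refl ← unique x′#y′ occ′ =
        contradiction x′<y′ (<-asym y<x)
      only _     x′#y′ (inj₂ occ′) with refl ← unique (x′#y′ ∘ sym) occ′ = refl

  -- Games inside the holes

  holeGames : Hole → List (Game N)
  holeGames p = map (mapGame (player p) (player-injective p)) (C.games p)

  module _ (s t : Seat) where

    count-holeGames-zero : ∀ {a b} p → ¬ (holeOf a ≡ p × holeOf b ≡ p) →
                           count (meet? s t a b) (holeGames p) ≡ 0
    count-holeGames-zero {a} {b} p outside-p = count-map-none (meet? s t a b) outside′ (C.games p)
      where
      outside′ : ∀ g → ¬ Meet s t a b (mapGame (player p) (player-injective p) g)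
      outside′ g met with Meet-mapGame⇒image (player p) (player-injective p) s t g met
      ... | (u , refl) , (v , refl) = outside-p (holeOf-player p u , holeOf-player p v)

    count-holeGames-# : ∀ {a b} → a # b → count (meet? s t a b) (⋃ holeGames) ≡ 0
    count-holeGames-# {a} {b} a#b = count-⋃-zero (meet? s t a b) holeGames λ p →
      count-holeGames-zero p λ { (eq₁ , eq₂) → a#b (trans eq₁ (sym eq₂)) }

    count-holeGames-same : ∀ p u v → count (meet? s t (player p u) (player p v)) (⋃ holeGames) ≡
                                     count (meet? s t u v) (C.games p)
    count-holeGames-same p u v = trans
      (count-⋃-single (meet? s t _ _) holeGames p λ q q≢p → count-holeGames-zero q
        λ { (eq , _) → q≢p (trans (sym eq) (holeOf-player p u)) })
      (count-map (meet? s t _ _) (meet? s t u v)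
        (Meet-mapGame (player p) (player-injective p) s t u v) (C.games p))

  allGames : List (Game N)
  allGames = crossGames ++ ⋃ holeGames

  -- Here the sum over the two kinds of games is 1 + 0. In `meetings-same` it is 0 plus the count in
  -- the hole's own tournament.
  meetings-# : ∀ {s t} → Transversal s t → ∀ {a b} → a # b →
               count (meet? s t a b) allGames ≡ 1
  meetings-# {s} {t} T {a} {b} a#b = trans (count-++ (meet? s t a b) crossGames (⋃ holeGames))
    (cong₂ _+_ (count-crossGames-# T a#b) (count-holeGames-# s t a#b))

  meetings-same : ∀ {s t} → Transversal s t → ∀ p u v →
                  count (meet? s t (player p u) (player p v)) allGames ≡
                  count (meet? s t u v) (C.games p)
  meetings-same {s} {t} T p u v =
    trans (count-++ (meet? s t (player p u) (player p v)) crossGames (⋃ holeGames))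
      (cong₂ _+_ (count-crossGames-same T (trans (holeOf-player p u) (sym (holeOf-player p v))))
                 (count-holeGames-same s t p u v))

  -- Spouse pairs

  module Index = Inverse (sum-sum↔Σ n m)

  -- `f` will be `C.husband` or `C.wife`. Both decode `q` in the same way, so each new couple is a
  -- couple of a single hole's tournament.
  place : (∀ p → Fin (uncurry m p) → Fin (h (proj₁ p))) → Fin (sum λ i → sum λ j → m i j) → Fin N
  place f q = let p , r = Index.to q in player p (f p r)

  place-injective : ∀ f → (∀ p → Injective _≡_ _≡_ (f p)) → Injective _≡_ _≡_ (place f)
  place-injective f f-injective {q} {q′} eq =
    trans (sym (Index.strictlyInverseʳ q))
      (trans (cong Index.from (pairs (Index.to q) (Index.to q′) eq)) (Index.strictlyInverseʳ q′))
    where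
    -- Stated for arbitrary `x` and `y`, since identifying the two holes by `refl` needs variables
    -- in place of `Index.to q` and `Index.to q′`.
    pairs : ∀ (x y : Σ Hole (Fin ∘ uncurry m)) →
            player (proj₁ x) (f _ (proj₂ x)) ≡ player (proj₁ y) (f _ (proj₂ y)) → x ≡ y
    pairs (p , r) (p′ , r′) eq
      with refl ← trans (sym (holeOf-player p _)) (trans (cong holeOf eq) (holeOf-player p′ _)) =
      cong (p ,_) (f-injective p (player-injective p eq))

  -- Agrees definitionally with `CMDRR.Spouses` of `filled`, whose fields are proved from the facts
  -- below.
  Spouses : Fin N → Fin N → Set
  Spouses a b = ∃ λ q → place C.husband q ≡ a × place C.wife q ≡ b

  data LocalSpouses : Fin N → Fin N → Set where
    local : ∀ p {u v} → C.Spouses p u v → LocalSpouses (player p u) (player p v)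

  Spouses⇒LocalSpouses : ∀ {a b} → Spouses a b → LocalSpouses a b
  Spouses⇒LocalSpouses (q , refl , refl) = local _ (_ , refl , refl)

  Spouses⇒¬# : ∀ {a b} → Spouses a b → ¬ a # b
  Spouses⇒¬# ab a#b with Spouses⇒LocalSpouses ab
  ... | local p _ = a#b (trans (holeOf-player p _) (sym (holeOf-player p _)))

  Spouses⁺ : ∀ p {u v} → C.Spouses p u v → Spouses (player p u) (player p v)
  Spouses⁺ p (r , refl , refl) =
    Index.from (p , r) , placed C.husband , placed C.wife
    where
    placed : ∀ f → place f (Index.from (p , r)) ≡ player p (f p r)
    placed f = cong (λ x → player (proj₁ x) (f (proj₁ x) (proj₂ x))) (Index.strictlyInverseˡ (p , r))

  Spouses⁻ : ∀ p {u v} → Spouses (player p u) (player p v) → C.Spouses p u v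
  Spouses⁻ p {u} {v} ab = go refl refl (Spouses⇒LocalSpouses ab)
    where
    -- Equations replace the indices `player p u` and `player p v`, which unification cannot invert.
    go : ∀ {a b} → a ≡ player p u → b ≡ player p v → LocalSpouses a b → C.Spouses p u v
    go a≡ b≡ (local q uv)
      with refl ← trans (sym (holeOf-player q _)) (trans (cong holeOf a≡) (holeOf-player p u)) =
      subst₂ (C.Spouses p) (player-injective p a≡) (player-injective p b≡) uv

  HasWife⇔ : ∀ p u → (∃ λ b → Spouses (player p u) b) ⇔ (∃ λ v → C.Spouses p u v)
  HasWife⇔ p u = mk⇔ wife⁻ λ (v , uv) → player p v , Spouses⁺ p uv
    where
    wife⁻ : (∃ λ b → Spouses (player p u) b) → ∃ λ v → C.Spouses p u v
    wife⁻ (b , ab) with relative p u b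
    ... | inj₁ (v , refl) = v , Spouses⁻ p ab
    ... | inj₂ a#b        = contradiction a#b (Spouses⇒¬# ab)

  HasHusband⇔ : ∀ p v → (∃ λ a → Spouses a (player p v)) ⇔ (∃ λ u → C.Spouses p u v)
  HasHusband⇔ p v = mk⇔ husband⁻ λ (u , uv) → player p u , Spouses⁺ p uv
    where
    husband⁻ : (∃ λ a → Spouses a (player p v)) → ∃ λ u → C.Spouses p u v
    husband⁻ (a , ab) with relative p v a
    ... | inj₁ (u , refl) = u , Spouses⁻ p ab
    ... | inj₂ b#a        = contradiction (b#a ∘ sym) (Spouses⇒¬# ab)

  -- Players of other holes are met exactly once through the cross games, so the conditions reduce
  -- to those inside the hole. In particular, the person met twice by an unspoused player is the one
  -- from the hole's tournament, and no further exception arises.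
  SameSexOpposition-fill :
    ∀ {s t} → Transversal s t →
    ∀ {HasSpouse : Fin N → Set} {HasSpouseₚ : ∀ p → Fin (h (proj₁ p)) → Set} →
    (∀ p u → HasSpouse (player p u) ⇔ HasSpouseₚ p u) →
    (∀ p → SameSexOpposition (HasSpouseₚ p) λ u v → count (meet? s t u v) (C.games p)) →
    SameSexOpposition HasSpouse λ x y → count (meet? s t x y) allGames
  SameSexOpposition-fill {s} {t} T {HasSpouse} spouse⇔ inHole = record
    { spoused = spoused ; unspoused = unspoused }
    where
    module O p = SameSexOpposition (inHole p)
    module E p u = Equivalence (spouse⇔ p u)

    meetings : Fin N → Fin N → ℕ
    meetings x y = count (meet? s t x y) allGames

    spoused : ∀ x → HasSpouse x → ∀ y → y ≢ x → meetings x y ≡ 1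
    spoused x hs y y≢x with localise x
    ... | local p u with relative p u y
    ...   | inj₁ (v , refl) = trans (meetings-same T p u v)
                                (O.spoused p u (E.to p u hs) v (y≢x ∘ cong (player p)))
    ...   | inj₂ x#y        = meetings-# T x#y

    unspoused : ∀ x → ¬ HasSpouse x → ∃ λ y → y ≢ x × ¬ HasSpouse y × meetings x y ≡ 2 ×
                (∀ z → z ≢ x → z ≢ y → meetings x z ≡ 1)
    unspoused x ¬hs with localise x
    ... | local p u with O.unspoused p u (¬hs ∘ E.from p u)
    ...   | v , v≢u , ¬hsᵥ , twice , once =
      player p v , v≢u ∘ player-injective p , ¬hsᵥ ∘ E.to p v ,
      trans (meetings-same T p u v) twice , others
      where
      others : ∀ z → z ≢ player p u → z ≢ player p v → meetings (player p u) z ≡ 1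
      others z z≢x z≢y with relative p u z
      ... | inj₁ (w , refl) = trans (meetings-same T p u w)
                                (once w (z≢x ∘ cong (player p)) (z≢y ∘ cong (player p)))
      ... | inj₂ x#z        = meetings-# T x#z

  nonspouses-once : ∀ {s t} → Transversal s t →
    (∀ p u v → ¬ C.Spouses p u v → count (meet? s t u v) (C.games p) ≡ 1) →
    ∀ a b → ¬ Spouses a b → count (meet? s t a b) allGames ≡ 1
  nonspouses-once T once a b ¬ab with localise a
  ... | local p u with relative p u b
  ...   | inj₁ (v , refl) = trans (meetings-same T p u v) (once p u v (¬ab ∘ Spouses⁺ p))
  ...   | inj₂ a#b        = meetings-# T a#b

  filled : CMDRR N (sum λ i → sum λ j → m i j)
  filled = record
    { husband           = place C.husband
    ; wife              = place C.wife
    ; husband-injective = place-injective C.husband C.husband-injective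
    ; wife-injective    = place-injective C.wife C.wife-injective
    ; games             = allGames
    ; spouses-apart     = λ a b ab → apart (Spouses⇒LocalSpouses ab)
    ; partners-once     = nonspouses-once partners-transversal C.partners-once
    ; opponents-once    = nonspouses-once opponents-transversal C.opponents-once
    ; men               = SameSexOpposition-fill men-transversal HasWife⇔ C.men
    ; women             = SameSexOpposition-fill women-transversal HasHusband⇔ C.women
    }
    where
    apart : ∀ {a b} → LocalSpouses a b →
            count (partners? a b) allGames ≡ 0 × count (opponents? a b) allGames ≡ 0
    apart (local p {u} {v} uv) =
      let noPartners , noOpponents = C.spouses-apart p u v uv in
      trans (meetings-same partners-transversal p u v) noPartners ,
      trans (meetings-same opponents-transversal p u v) noOpponents

theorem1 : ∀ {k : ℕ} (h n : Fin k → ℕ) (m : (i : Fin k) → Fin (n i) → ℕ) →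
    HSOLS h n →
    (∀ i j → CMDRR (h i) (m i j)) →
    CMDRR (sum λ i → n i * h i) (sum λ i → sum λ j → m i j)
theorem1 h n m S C = Construction.filled h n m S C
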